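{- Let $n$ be a natural number. For every natural number $a$ with $\gcd(a,n)=1$, the bijection $\pi_a:\mathbb{Z}_n\to\mathbb{Z}_n$ defined by $\pi_a(x)=ax \pmod n$ has cycle type $$\mathrm{ctype}(\pi_a)=\prod_{d\mid n} x_{r_a(d)}^{\frac{\phi(d)}{r_a(d)}},$$ where the product is over all positive divisors $d$ of $n$. Accordingly, the cycle index of $\mathcal{U}_n$ acting on $\mathbb{Z}_n$ is $$\mathcal{Z}_{(\mathcal{U}_n,\mathbb{Z}_n)}=\frac{1}{\phi(n)}\sum_{a\in\mathcal{U}_n}\ \prod_{d\mid n} x_{r_a(d)}^{\frac{\phi(d)}{r_a(d)}}.$$
   Context: Natural numbers are positive integers; $\phi$ is Euler's phi function. $\mathbb{Z}_n$ is the set (additive group) of residues modulo $n$. $\mathcal{U}_n=\mathrm{Aut}(\mathbb{Z}_n)$ is identified with the set of residues $a$ modulo $n$ with $\gcd(a,n)=1$, where $a$ corresponds to the map $\pi_a(x)=ax \pmod n$; it acts on the $n$ points of $\mathbb{Z}_n$ by multiplication. For $\gcd(a,d)=1$, $r_a(d)=\min\{k\in\mathbb{N}: a^k\equiv 1 \pmod d\}$ is the multiplicative order of $a$ modulo $d$ (so $r_a(1)=1$). For a permutation $\pi$ of a finite set with $N$ elements, $\mathrm{ctype}(\pi)=\prod_{i=1}^N x_i^{\lambda_i(\pi)}$, where $x_1,x_2,\dots$ are formal indeterminates and $\lambda_i(\pi)$ is the number of cycles of length $i$ (fixed points counted as cycles of length 1) in the disjoint cycle decomposition of $\pi$. The cycle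 index of a finite permutation group $G$ on a finite set $P$ is $\mathcal{Z}_{(G,P)}=\frac{1}{|G|}\sum_{\pi\in G}\mathrm{ctype}(\pi)$. -}

module Defs where

open import Algebra.Bundles using (CommutativeRing)
import Algebra.Properties.Semiring.Exp as Exp
open import Data.Bool.Base using (if_then_else_)
open import Data.Empty using (⊥-elim)
open import Data.Fin.Base using (Fin; toℕ)
import Data.Fin.Base as Fin
import Data.Fin.Properties as Fin
open import Data.Fin.Permutation as Perm using (Permutation′; permutation; _⟨$⟩ʳ_; _⟨$⟩ˡ_; _∘ₚ_)
open import Data.Fin.Subset using (Subset; ⁅_⁆; ⋃; ∣_∣)
open import Data.Integer.Base using (+_)
open import Data.List.Base using (List; []; _∷_; map; foldr; filter; length; applyUpTo; allFin; iterate; deduplicate)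
open import Data.List.Membership.Propositional using () renaming (_∈_ to _∈ₗ_)
open import Data.List.Membership.Propositional.Properties using (∈-filter⁺; ∈-allFin)
open import Data.List.Properties using (filter-accept)
open import Data.List.Relation.Unary.All as All using (All)
open import Data.List.Relation.Unary.All.Properties using (all-filter)
open import Data.List.Relation.Unary.AllPairs as AllPairs using (AllPairs)
import Data.List.Relation.Unary.AllPairs.Properties as AllPairs
open import Data.List.Relation.Unary.Any as Any using (Any; here; there)
import Data.List.Relation.Unary.Any.Properties as Any
import Data.List.Relation.Unary.Unique.Propositional.Properties as Unique
open import Data.Nat.Base using (ℕ; zero; suc; _≤_; _<_; _*_; _∸_; ∣_-_∣; NonZero; z≤n; s≤s)
import Data.Nat.Base as ℕ
open import Data.Nat.Coprimality using (Coprime; coprime⇒gcd≡1; gcd≡1⇒coprime; coprime-divisor)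
import Data.Nat.Coprimality as Coprime
open import Data.Nat.DivMod using (_%_; _mod_; %-distribˡ-*; m%n%n≡m%n; m<n⇒m%n≡m; [m+kn]%n≡m%n; m≡m%n+[m/n]*n; m%n<n)
import Data.Nat.DivMod as ℕ
open import Data.Nat.Divisibility using (_∣_; divides; _∣?_; ∣-trans; ∣n∣m%n⇒∣m)
open import Data.Nat.GCD using (gcd; gcd-zeroˡ)
import Data.Nat.Properties as ℕ
open import Data.Product.Base using (∃; Σ; _×_; _,_; proj₁; proj₂)
open import Data.Rational.Base using (ℚ; 0ℚ; 1ℚ)
import Data.Rational.Base as ℚ
import Data.Rational.Properties as ℚ
open import Data.Sum.Base using (inj₁; inj₂)
open import Data.Vec.Properties using () renaming (≡-dec to Vec-≡-dec)
import Data.Bool.Properties as Bool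
open import Function.Base using (_∘_)
open import Level using (0ℓ)
open import Relation.Binary.Definitions using (DecidableEquality)
open import Relation.Binary.Structures using (IsEquivalence)
open import Relation.Binary.PropositionalEquality
open import Relation.Nullary.Decidable using (yes; no; does)
open import Relation.Nullary.Negation using (¬_)
open import Relation.Unary using (Pred; Decidable)

------------------------------------------------------------------------
-- Polynomials over ℚ

-- ℚ[x₁, x₂, …] as the free commutative ℚ-algebra on the indeterminates:
-- terms modulo the congruence _≈_ below.  The index 0 gives one spare
-- indeterminate, which never occurs in a cycle type.

infixl 6 _⊕_
infixl 7 _⊗_
infix  4 _≈_

data Poly : Set where
  con     : ℚ → Poly
  x       : ℕ → Poly
  _⊕_ _⊗_ : Poly → Poly → Poly

data _≈_ : Poly → Poly → Set where
  ≈-refl      : ∀ {p} → p ≈ p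
  ≈-sym       : ∀ {p q} → p ≈ q → q ≈ p
  ≈-trans     : ∀ {p q s} → p ≈ q → q ≈ s → p ≈ s
  ⊕-cong      : ∀ {p p′ q q′} → p ≈ p′ → q ≈ q′ → p ⊕ q ≈ p′ ⊕ q′
  ⊗-cong      : ∀ {p p′ q q′} → p ≈ p′ → q ≈ q′ → p ⊗ q ≈ p′ ⊗ q′
  ⊕-assoc     : ∀ p q s → (p ⊕ q) ⊕ s ≈ p ⊕ (q ⊕ s)
  ⊕-comm      : ∀ p q → p ⊕ q ≈ q ⊕ p
  ⊕-identityˡ : ∀ p → con 0ℚ ⊕ p ≈ p
  ⊗-assoc     : ∀ p q s → (p ⊗ q) ⊗ s ≈ p ⊗ (q ⊗ s)
  ⊗-comm      : ∀ p q → p ⊗ q ≈ q ⊗ p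
  ⊗-identityˡ : ∀ p → con 1ℚ ⊗ p ≈ p
  ⊗-distribˡ  : ∀ p q s → p ⊗ (q ⊕ s) ≈ (p ⊗ q) ⊕ (p ⊗ s)
  ⊗-zeroˡ     : ∀ p → con 0ℚ ⊗ p ≈ con 0ℚ
  con-⊕       : ∀ a b → con (a ℚ.+ b) ≈ con a ⊕ con b
  con-⊗       : ∀ a b → con (a ℚ.* b) ≈ con a ⊗ con b

polyRing : CommutativeRing 0ℓ 0ℓ
polyRing = record
  { Carrier = Poly ; _≈_ = _≈_ ; _+_ = _⊕_ ; _*_ = _⊗_
  ; -_ = neg ; 0# = con 0ℚ ; 1# = con 1ℚ
  ; isCommutativeRing = record
    { isRing = record
      { +-isAbelianGroup = record
        { isGroup = record
          { isMonoid = record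
            { isSemigroup = record
              { isMagma = record { isEquivalence = isEquiv ; ∙-cong = ⊕-cong }
              ; assoc = ⊕-assoc }
            ; identity = ⊕-identityˡ , λ p → ≈-trans (⊕-comm _ _) (⊕-identityˡ p) }
          ; inverse = inverseˡ , λ p → ≈-trans (⊕-comm _ _) (inverseˡ p)
          ; ⁻¹-cong = ⊗-cong ≈-refl }
        ; comm = ⊕-comm }
      ; *-cong = ⊗-cong
      ; *-assoc = ⊗-assoc
      ; *-identity = ⊗-identityˡ , λ p → ≈-trans (⊗-comm _ _) (⊗-identityˡ p)
      ; distrib = ⊗-distribˡ , distribʳ }
    ; *-comm = ⊗-comm } }
  where
  neg : Poly → Poly
  neg p = con (ℚ.- 1ℚ) ⊗ p

  isEquiv : IsEquivalence _≈_
  isEquiv = record { refl = ≈-refl ; sym = ≈-sym ; trans = ≈-trans }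

  distribʳ : ∀ p q s → (q ⊕ s) ⊗ p ≈ (q ⊗ p) ⊕ (s ⊗ p)
  distribʳ p q s = ≈-trans (⊗-comm _ _)
    (≈-trans (⊗-distribˡ p q s) (⊕-cong (⊗-comm _ _) (⊗-comm _ _)))

  inverseˡ : ∀ p → neg p ⊕ p ≈ con 0ℚ
  inverseˡ p = ≈-trans (⊕-cong ≈-refl (≈-sym (⊗-identityˡ p)))
    (≈-trans (≈-sym (distribʳ p _ _))
    (≈-trans (⊗-cong (≈-sym (con-⊕ (ℚ.- 1ℚ) 1ℚ)) ≈-refl) (⊗-zeroˡ p)))

open Exp (CommutativeRing.semiring polyRing) using (_^_) public

-- Equal polynomials have equal values, so _≈_ does not collapse.

eval : (ℕ → ℚ) → Poly → ℚ
eval ρ (con a) = a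
eval ρ (x i)   = ρ i
eval ρ (p ⊕ q) = eval ρ p ℚ.+ eval ρ q
eval ρ (p ⊗ q) = eval ρ p ℚ.* eval ρ q

eval-cong : ∀ ρ {p q} → p ≈ q → eval ρ p ≡ eval ρ q
eval-cong ρ ≈-refl              = refl
eval-cong ρ (≈-sym e)           = sym (eval-cong ρ e)
eval-cong ρ (≈-trans e f)       = trans (eval-cong ρ e) (eval-cong ρ f)
eval-cong ρ (⊕-cong e f)        = cong₂ ℚ._+_ (eval-cong ρ e) (eval-cong ρ f)
eval-cong ρ (⊗-cong e f)        = cong₂ ℚ._*_ (eval-cong ρ e) (eval-cong ρ f)
eval-cong ρ (⊕-assoc p q s)     = ℚ.+-assoc (eval ρ p) (eval ρ q) (eval ρ s)
eval-cong ρ (⊕-comm p q)        = ℚ.+-comm (eval ρ p) (eval ρ q)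
eval-cong ρ (⊕-identityˡ p)     = ℚ.+-identityˡ (eval ρ p)
eval-cong ρ (⊗-assoc p q s)     = ℚ.*-assoc (eval ρ p) (eval ρ q) (eval ρ s)
eval-cong ρ (⊗-comm p q)        = ℚ.*-comm (eval ρ p) (eval ρ q)
eval-cong ρ (⊗-identityˡ p)     = ℚ.*-identityˡ (eval ρ p)
eval-cong ρ (⊗-distribˡ p q s)  = ℚ.*-distribˡ-+ (eval ρ p) (eval ρ q) (eval ρ s)
eval-cong ρ (⊗-zeroˡ p)         = ℚ.*-zeroˡ (eval ρ p)
eval-cong ρ (con-⊕ a b)         = refl
eval-cong ρ (con-⊗ a b)         = refl

∑ ∏ : ∀ {a} {A : Set a} → List A → (A → Poly) → Poly
∑ as f = foldr _⊕_ (con 0ℚ) (map f as)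
∏ as f = foldr _⊗_ (con 1ℚ) (map f as)

infixr 5 ∑ ∏
syntax ∑ as (λ a → p) = ∑[ a ← as ] p
syntax ∏ as (λ a → p) = ∏[ a ← as ] p

------------------------------------------------------------------------
-- Arithmetic functions

[1⋯_] : ℕ → List ℕ
[1⋯ n ] = applyUpTo suc n

divisors : ℕ → List ℕ
divisors n = filter (_∣? n) [1⋯ n ]

φ : ℕ → ℕ
φ n = length (filter (λ k → gcd k n ℕ.≟ 1) [1⋯ n ])

instance
  φ-nonZero : ∀ {n} .{{_ : NonZero n}} → NonZero (φ n)
  φ-nonZero {n@(suc m)} = subst (NonZero ∘ length)
    (sym (filter-accept (λ k → gcd k n ℕ.≟ 1) {1} {applyUpTo (suc ∘ suc) m} (gcd-zeroˡ n))) _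

infix 4 _≡_[mod_]

_≡_[mod_] : ℕ → ℕ → ℕ → Set
a ≡ b [mod d ] = d ∣ ∣ a - b ∣

-- The least k with P k, provided P holds somewhere in {0, …, b}.

least : ∀ {P : Pred ℕ 0ℓ} → Decidable P → ℕ → ℕ
least P? zero    = zero
least P? (suc b) = if does (P? zero) then zero else suc (least (P? ∘ suc) b)

least-spec : ∀ {P : Pred ℕ 0ℓ} (P? : Decidable P) b {m} → m ≤ b → P m →
             P (least P? b) × (∀ k → P k → least P? b ≤ k)
least-spec P? zero    z≤n  pm = pm , λ _ _ → z≤n
least-spec P? (suc b) m≤b pm with P? zero
... | yes p0 = p0 , λ _ _ → z≤n
least-spec P? (suc b) {zero}  m≤b       pm | no ¬p0 = ⊥-elim (¬p0 pm)
least-spec P? (suc b) {suc m} (s≤s m≤b) pm | no ¬p0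
  with pl , minimal ← least-spec (P? ∘ suc) b m≤b pm
  = pl , λ { zero p0 → ⊥-elim (¬p0 p0) ; (suc k) pk → s≤s (minimal k pk) }

-- The multiplicative order of a modulo d, i.e. the least k ≥ 1 with
-- aᵏ ≡ 1 (mod d).  Searching up to suc d is enough when gcd(a, d) = 1
-- (see r-spec); otherwise the value is irrelevant.

r : ℕ → ℕ → ℕ
r a d = suc (least (λ k → d ∣? ∣ a ℕ.^ suc k - 1 ∣) d)

≡%⇒≡mod : ∀ a b d .{{_ : NonZero d}} → a % d ≡ b % d → a ≡ b [mod d ]
≡%⇒≡mod a b d eq = divides ∣ a ℕ./ d - b ℕ./ d ∣ (begin
  ∣ a - b ∣
    ≡⟨ cong₂ ∣_-_∣ (m≡m%n+[m/n]*n a d) (m≡m%n+[m/n]*n b d) ⟩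
  ∣ a % d ℕ.+ a ℕ./ d * d - b % d ℕ.+ b ℕ./ d * d ∣
    ≡⟨ cong (λ z → ∣ z ℕ.+ a ℕ./ d * d - b % d ℕ.+ b ℕ./ d * d ∣) eq ⟩
  ∣ b % d ℕ.+ a ℕ./ d * d - b % d ℕ.+ b ℕ./ d * d ∣
    ≡⟨ ℕ.∣m+n-m+o∣≡∣n-o∣ (b % d) _ _ ⟩
  ∣ a ℕ./ d * d - b ℕ./ d * d ∣
    ≡⟨ ℕ.*-distribʳ-∣-∣ d (a ℕ./ d) (b ℕ./ d) ⟨
  ∣ a ℕ./ d - b ℕ./ d ∣ * d ∎)
  where open ≡-Reasoning

≡mod⇒≡% : ∀ a b d .{{_ : NonZero d}} → a ≡ b [mod d ] → a % d ≡ b % d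
≡mod⇒≡% a b d (divides q eq) with ℕ.≤-total a b
... | inj₁ a≤b = sym (trans (cong (_% d) b≡) ([m+kn]%n≡m%n a q d))
  where
  b≡ : b ≡ a ℕ.+ q * d
  b≡ = trans (sym (ℕ.m+[n∸m]≡n a≤b)) (cong (a ℕ.+_) (trans (sym (ℕ.m≤n⇒∣m-n∣≡n∸m a≤b)) eq))
... | inj₂ b≤a = trans (cong (_% d) a≡) ([m+kn]%n≡m%n b q d)
  where
  a≡ : a ≡ b ℕ.+ q * d
  a≡ = trans (sym (ℕ.m+[n∸m]≡n b≤a)) (cong (b ℕ.+_)
    (trans (sym (ℕ.m≤n⇒∣m-n∣≡n∸m b≤a)) (trans (ℕ.∣-∣-comm b a) eq)))

r-spec : ∀ a d .{{_ : NonZero d}} → gcd a d ≡ 1 →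
         (a ℕ.^ r a d ≡ 1 [mod d ]) ×
         (∀ k .{{_ : NonZero k}} → a ℕ.^ k ≡ 1 [mod d ] → r a d ≤ k)
r-spec a d c = result
  where
  cancel : ∀ i m → d ∣ a ℕ.^ i * m → d ∣ m
  cancel zero    m d∣ = subst (d ∣_) (ℕ.*-identityˡ m) d∣
  cancel (suc i) m d∣ = cancel i m
    (coprime-divisor {d} {a} {a ℕ.^ i * m} (Coprime.sym (gcd≡1⇒coprime {a} {d} c)) (subst (d ∣_) (ℕ.*-assoc a (a ℕ.^ i) m) d∣))

  power : Fin (suc d) → Fin d
  power i = (a ℕ.^ toℕ i) mod d

  exists : ∃ λ m → m ≤ d × (a ℕ.^ suc m ≡ 1 [mod d ])
  exists with i , j , i<j , eq ← Fin.pigeonhole (ℕ.n<1+n d) power =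
    m , m≤d , cancel (toℕ i) ∣ a ℕ.^ suc m - 1 ∣ (subst (d ∣_) factor
      (≡%⇒≡mod (a ℕ.^ toℕ j) (a ℕ.^ toℕ i) d (sym (Fin.fromℕ<-injective _ _ _ _ eq))))
    where
    m = toℕ j ∸ suc (toℕ i)
    m≤d : m ≤ d
    m≤d = ℕ.≤-trans (ℕ.m∸n≤m (toℕ j) (suc (toℕ i))) (ℕ.≤-pred (Fin.toℕ<n j))
    j≡ : toℕ j ≡ toℕ i ℕ.+ suc m
    j≡ = trans (sym (ℕ.m+[n∸m]≡n i<j)) (sym (ℕ.+-suc (toℕ i) m))
    factor : ∣ a ℕ.^ toℕ j - a ℕ.^ toℕ i ∣ ≡ a ℕ.^ toℕ i * ∣ a ℕ.^ suc m - 1 ∣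
    factor = begin
      ∣ a ℕ.^ toℕ j - a ℕ.^ toℕ i ∣
        ≡⟨ cong₂ ∣_-_∣ (trans (cong (a ℕ.^_) j≡) (ℕ.^-distribˡ-+-* a (toℕ i) (suc m)))
                       (sym (ℕ.*-identityʳ (a ℕ.^ toℕ i))) ⟩
      ∣ a ℕ.^ toℕ i * a ℕ.^ suc m - a ℕ.^ toℕ i * 1 ∣
        ≡⟨ ℕ.*-distribˡ-∣-∣ (a ℕ.^ toℕ i) (a ℕ.^ suc m) 1 ⟨
      a ℕ.^ toℕ i * ∣ a ℕ.^ suc m - 1 ∣ ∎
      where open ≡-Reasoning

  result : (a ℕ.^ r a d ≡ 1 [mod d ]) × (∀ k .{{_ : NonZero k}} → a ℕ.^ k ≡ 1 [mod d ] → r a d ≤ k)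
  result with m , m≤d , am ← exists
         with pl , minimal ← least-spec (λ k → d ∣? ∣ a ℕ.^ suc k - 1 ∣) d m≤d am
    = pl , λ { (suc k) ak → s≤s (minimal k ak) }

------------------------------------------------------------------------
-- Cycle types

_≟ₛ_ : ∀ {N} → DecidableEquality (Subset N)
_≟ₛ_ = Vec-≡-dec Bool._≟_

-- The underlying set {i, π i, π² i, …} of the cycle of π through i; as π
-- permutes N points, the first N iterates exhaust it.

cycle : ∀ {N} → Permutation′ N → Fin N → Subset N
cycle {N} π i = ⋃ (map ⁅_⁆ (iterate (π ⟨$⟩ʳ_) i N))

cycles : ∀ {N} → Permutation′ N → List (Subset N)
cycles {N} π = deduplicate _≟ₛ_ (map (cycle π) (allFin N))

#cycles : ∀ {N} → ℕ → Permutation′ N → ℕ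
#cycles i π = length (filter (λ c → ∣ c ∣ ℕ.≟ i) (cycles π))

ctype : ∀ {N} → Permutation′ N → Poly
ctype {N} π = ∏[ i ← [1⋯ N ] ] x i ^ #cycles i π

------------------------------------------------------------------------
-- Permutation groups and their cycle index

-- A subgroup of the symmetric group on Fin N, given by a list of its
-- elements without repetition.  Permutations are compared pointwise.

record PermutationGroup (N : ℕ) : Set where
  infix 4 _∈G
  field
    elements : List (Permutation′ N)
    distinct : AllPairs (λ π ρ → ¬ (π Perm.≈ ρ)) elements

  _∈G : Permutation′ N → Set
  π ∈G = Any (π Perm.≈_) elements

  field
    id-closed   : Perm.id ∈G
    ∘-closed    : ∀ π ρ → π ∈G → ρ ∈G → π ∘ₚ ρ ∈G
    flip-closed : ∀ π → π ∈G → Perm.flip π ∈G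

  order : ℕ
  order = length elements

  order-nonZero : NonZero order
  order-nonZero = nonEmpty id-closed
    where
    nonEmpty : ∀ {πs} → Any (Perm.id Perm.≈_) πs → NonZero (length πs)
    nonEmpty (here _)  = _
    nonEmpty (there _) = _

cycleIndex : ∀ {N} → PermutationGroup N → Poly
cycleIndex G = con (ℚ._/_ (+ 1) order {{order-nonZero}}) ⊗ (∑[ π ← elements ] ctype π)
  where open PermutationGroup G

------------------------------------------------------------------------
-- Multiplication by units on ℤₙ, with ℤₙ = Fin n

*-%ʳ : ∀ a m n .{{_ : NonZero n}} → (a * (m % n)) % n ≡ (a * m) % n
*-%ʳ a m n = begin
  (a * (m % n)) % n             ≡⟨ %-distribˡ-* a (m % n) n ⟩
  ((a % n) * (m % n % n)) % n   ≡⟨ cong (λ z → ((a % n) * z) % n) (m%n%n≡m%n m n) ⟩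
  ((a % n) * (m % n)) % n       ≡⟨ %-distribˡ-* a m n ⟨
  (a * m) % n                   ∎
  where open ≡-Reasoning

*-%ˡ : ∀ a m n .{{_ : NonZero n}} → ((a % n) * m) % n ≡ (a * m) % n
*-%ˡ a m n = begin
  ((a % n) * m) % n   ≡⟨ cong (_% n) (ℕ.*-comm (a % n) m) ⟩
  (m * (a % n)) % n   ≡⟨ *-%ʳ m a n ⟩
  (m * a) % n         ≡⟨ cong (_% n) (ℕ.*-comm m a) ⟩
  (a * m) % n         ∎
  where open ≡-Reasoning

mult : ∀ n .{{_ : NonZero n}} → ℕ → Fin n → Fin n
mult n a i = (a * toℕ i) mod n

toℕ-mult : ∀ n .{{_ : NonZero n}} a i → toℕ (mult n a i) ≡ (a * toℕ i) % n
toℕ-mult n a i = Fin.toℕ-fromℕ< _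

mult-∘ : ∀ n .{{_ : NonZero n}} a b i → mult n a (mult n b i) ≡ mult n (a * b) i
mult-∘ n a b i = Fin.toℕ-injective (begin
  toℕ (mult n a (mult n b i))   ≡⟨ toℕ-mult n a _ ⟩
  (a * toℕ (mult n b i)) % n    ≡⟨ cong (λ z → (a * z) % n) (toℕ-mult n b i) ⟩
  (a * ((b * toℕ i) % n)) % n   ≡⟨ *-%ʳ a (b * toℕ i) n ⟩
  (a * (b * toℕ i)) % n         ≡⟨ cong (_% n) (ℕ.*-assoc a b (toℕ i)) ⟨
  (a * b * toℕ i) % n           ≡⟨ toℕ-mult n (a * b) i ⟨
  toℕ (mult n (a * b) i)        ∎)
  where open ≡-Reasoning

mult-cong : ∀ n .{{_ : NonZero n}} {a b} → a % n ≡ b % n → ∀ i → mult n a i ≡ mult n b i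
mult-cong n {a} {b} eq i = Fin.toℕ-injective (begin
  toℕ (mult n a i)          ≡⟨ toℕ-mult n a i ⟩
  (a * toℕ i) % n           ≡⟨ *-%ˡ a (toℕ i) n ⟨
  ((a % n) * toℕ i) % n     ≡⟨ cong (λ z → (z * toℕ i) % n) eq ⟩
  ((b % n) * toℕ i) % n     ≡⟨ *-%ˡ b (toℕ i) n ⟩
  (b * toℕ i) % n           ≡⟨ toℕ-mult n b i ⟨
  toℕ (mult n b i)          ∎)
  where open ≡-Reasoning

mult-1 : ∀ n .{{_ : NonZero n}} i → mult n 1 i ≡ i
mult-1 n i = Fin.toℕ-injective (begin
  toℕ (mult n 1 i)   ≡⟨ toℕ-mult n 1 i ⟩
  (1 * toℕ i) % n    ≡⟨ cong (_% n) (ℕ.*-identityˡ (toℕ i)) ⟩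
  toℕ i % n          ≡⟨ m<n⇒m%n≡m (Fin.toℕ<n i) ⟩
  toℕ i              ∎)
  where open ≡-Reasoning

-- a⁻¹ = a^(r-1), where r is the order of a modulo n

inv : ℕ → ℕ → ℕ
inv n a = a ℕ.^ ℕ.pred (r a n)

inv-%ʳ : ∀ n .{{_ : NonZero n}} a → gcd a n ≡ 1 → (a * inv n a) % n ≡ 1 % n
inv-%ʳ n a c = ≡mod⇒≡% (a * inv n a) 1 n (proj₁ (r-spec a n c))

inv-%ˡ : ∀ n .{{_ : NonZero n}} a → gcd a n ≡ 1 → (inv n a * a) % n ≡ 1 % n
inv-%ˡ n a c = trans (cong (_% n) (ℕ.*-comm (inv n a) a)) (inv-%ʳ n a c)

π : ∀ n .{{_ : NonZero n}} (a : ℕ) → gcd a n ≡ 1 → Permutation′ n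
π n a c = permutation (mult n a) (mult n (inv n a))
  (λ i → trans (mult-∘ n a (inv n a) i) (trans (mult-cong n (inv-%ʳ n a c) i) (mult-1 n i)))
  (λ i → trans (mult-∘ n (inv n a) a i) (trans (mult-cong n (inv-%ˡ n a c) i) (mult-1 n i)))

-- The residues a modulo n with gcd(a, n) = 1

Unit : ℕ → Set
Unit n = Σ (Fin n) λ a → gcd (toℕ a) n ≡ 1

unit? : ∀ n → Decidable (λ (a : Fin n) → gcd (toℕ a) n ≡ 1)
unit? n a = gcd (toℕ a) n ℕ.≟ 1

units : ∀ n → List (Unit n)
units n = All.toList (all-filter (unit? n) (allFin n))

coprime-* : ∀ {n} a b → Coprime a n → Coprime b n → Coprime (a * b) n
coprime-* a b ca cb {z} (z∣ab , z∣n) =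
  cb (coprime-divisor {z} {a} {b} (λ (w∣z , w∣a) → ca (w∣a , ∣-trans w∣z z∣n)) z∣ab , z∣n)

gcd-* : ∀ {n} a b → gcd a n ≡ 1 → gcd b n ≡ 1 → gcd (a * b) n ≡ 1
gcd-* {n} a b ca cb =
  coprime⇒gcd≡1 (coprime-* a b (gcd≡1⇒coprime {a} {n} ca) (gcd≡1⇒coprime {b} {n} cb))

gcd-^ : ∀ {n} a k → gcd a n ≡ 1 → gcd (a ℕ.^ k) n ≡ 1
gcd-^ {n} a zero    c = gcd-zeroˡ n
gcd-^     a (suc k) c = gcd-* a (a ℕ.^ k) c (gcd-^ a k c)

gcd-% : ∀ {n} .{{_ : NonZero n}} a → gcd a n ≡ 1 → gcd (a % n) n ≡ 1
gcd-% {n} a c = coprime⇒gcd≡1 λ (z∣a%n , z∣n) →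
  gcd≡1⇒coprime {a} {n} c (∣n∣m%n⇒∣m z∣n z∣a%n , z∣n)

πᵘ : ∀ n .{{_ : NonZero n}} → Unit n → Permutation′ n
πᵘ n (a , c) = π n (toℕ a) c

private
  module _ {A : Set} {P : A → Set} where
    toList-proj₁ : ∀ {as} (pas : All P as) → map proj₁ (All.toList pas) ≡ as
    toList-proj₁ All.[]         = refl
    toList-proj₁ (pa All.∷ pas) = cong (_ ∷_) (toList-proj₁ pas)

    toList-∈ : ∀ {as a} (pas : All P as) → a ∈ₗ as → Any (λ u → a ≡ proj₁ u) (All.toList pas)
    toList-∈ pas a∈as = Any.map⁻ (subst (_ ∈ₗ_) (sym (toList-proj₁ pas)) a∈as)

  units-distinct : ∀ n → AllPairs (λ u v → proj₁ u ≢ proj₁ v) (units n)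
  units-distinct n = AllPairs.map⁻ (subst (AllPairs _≢_)
    (sym (toList-proj₁ (all-filter (unit? n) (allFin n))))
    (Unique.filter⁺ (unit? n) (Unique.allFin⁺ n)))

  π-injective : ∀ n .{{_ : NonZero n}} (u v : Unit n) → πᵘ n u Perm.≈ πᵘ n v → proj₁ u ≡ proj₁ v
  π-injective n u v eq = Fin.toℕ-injective (trans (sym (at-1 u)) (trans (cong toℕ (eq (1 mod n))) (at-1 v)))
    where
    open ≡-Reasoning
    at-1 : ∀ (u : Unit n) → toℕ (πᵘ n u ⟨$⟩ʳ (1 mod n)) ≡ toℕ (proj₁ u)
    at-1 (a , c) = begin
      toℕ (mult n (toℕ a) (1 mod n))   ≡⟨ toℕ-mult n (toℕ a) _ ⟩
      (toℕ a * toℕ (1 mod n)) % n      ≡⟨ cong (λ z → (toℕ a * z) % n) (Fin.toℕ-fromℕ< (m%n<n 1 n)) ⟩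
      (toℕ a * (1 % n)) % n            ≡⟨ *-%ʳ (toℕ a) 1 n ⟩
      (toℕ a * 1) % n                  ≡⟨ cong (_% n) (ℕ.*-identityʳ (toℕ a)) ⟩
      toℕ a % n                        ≡⟨ m<n⇒m%n≡m (Fin.toℕ<n a) ⟩
      toℕ a                            ∎

  π-listed : ∀ n .{{_ : NonZero n}} a → gcd a n ≡ 1 → (ρ : Permutation′ n) →
             (∀ i → ρ ⟨$⟩ʳ i ≡ mult n a i) → Any (ρ Perm.≈_) (map (πᵘ n) (units n))
  π-listed n a c ρ ρ≗ = Any.map⁺ (Any.map (λ {u} → same {u})
    (toList-∈ (all-filter (unit? n) (allFin n)) (∈-filter⁺ (unit? n) (∈-allFin (a mod n))
      (trans (cong (λ z → gcd z n) toℕ-mod) (gcd-% a c)))))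
    where
    toℕ-mod : toℕ (a mod n) ≡ a % n
    toℕ-mod = Fin.toℕ-fromℕ< (m%n<n a n)
    same : ∀ {u} → a mod n ≡ proj₁ u → ρ Perm.≈ πᵘ n u
    same {u} refl i = trans (ρ≗ i) (mult-cong n (sym (trans (cong (_% n) toℕ-mod) (m%n%n≡m%n a n))) i)

  π-unlisted : ∀ n .{{_ : NonZero n}} {ρ : Permutation′ n} → Any (ρ Perm.≈_) (map (πᵘ n) (units n)) →
               ∃ λ u → ρ Perm.≈ πᵘ n u
  π-unlisted n ρ∈ = Any.satisfied (Any.map⁻ ρ∈)

-- 𝒰ₙ as a group of permutations of ℤₙ

𝒰 : ∀ n .{{_ : NonZero n}} → PermutationGroup n
𝒰 n = record
  { elements    = map (πᵘ n) (units n)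
  ; distinct    = AllPairs.map⁺ (AllPairs.map (λ {u} {v} u≢v eq → u≢v (π-injective n u v eq)) (units-distinct n))
  ; id-closed   = π-listed n 1 (gcd-zeroˡ n) Perm.id (λ i → sym (mult-1 n i))
  ; ∘-closed    = ∘-closed
  ; flip-closed = flip-closed
  }
  where
  open ≡-Reasoning

  ∘-closed : ∀ ρ σ → Any (ρ Perm.≈_) (map (πᵘ n) (units n)) → Any (σ Perm.≈_) (map (πᵘ n) (units n)) →
             Any ((ρ ∘ₚ σ) Perm.≈_) (map (πᵘ n) (units n))
  ∘-closed ρ σ ρ∈ σ∈ with (a , ca) , ρ≈ ← π-unlisted n {ρ} ρ∈ | (b , cb) , σ≈ ← π-unlisted n {σ} σ∈ =
    π-listed n (toℕ b * toℕ a) (gcd-* (toℕ b) (toℕ a) cb ca) (ρ ∘ₚ σ)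
      (λ i → trans (σ≈ _) (trans (cong (mult n (toℕ b)) (ρ≈ i)) (mult-∘ n (toℕ b) (toℕ a) i)))

  flip-closed : ∀ ρ → Any (ρ Perm.≈_) (map (πᵘ n) (units n)) →
                Any (Perm.flip ρ Perm.≈_) (map (πᵘ n) (units n))
  flip-closed ρ ρ∈ with u@(a , c) , ρ≈ ← π-unlisted n {ρ} ρ∈ =
    π-listed n (inv n (toℕ a)) (gcd-^ (toℕ a) (ℕ.pred (r (toℕ a) n)) c) (Perm.flip ρ) (λ i → begin
      ρ ⟨$⟩ˡ i                              ≡⟨ cong (ρ ⟨$⟩ˡ_) (Perm.inverseʳ (πᵘ n u)) ⟨
      ρ ⟨$⟩ˡ (πᵘ n u ⟨$⟩ʳ (πᵘ n u ⟨$⟩ˡ i))  ≡⟨ cong (ρ ⟨$⟩ˡ_) (ρ≈ _) ⟨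
      ρ ⟨$⟩ˡ (ρ ⟨$⟩ʳ (πᵘ n u ⟨$⟩ˡ i))       ≡⟨ Perm.inverseˡ ρ ⟩
      πᵘ n u ⟨$⟩ˡ i                         ∎)

{-# OPTIONS --safe #-}
-- Multiplication by a maps i to a point with the same denominator d of i/n
-- in lowest terms, and aᵏ fixes i exactly when aᵏ ≡ 1 (mod d); so i lies on a
-- cycle of length r a d.  Exactly φ d points have denominator d, for each
-- divisor d of n, hence they form φ d / r a d cycles of that length.

module Submission where

open import Defs
open import Algebra.Bundles using (CommutativeMonoid; CommutativeRing)
import Algebra.Definitions.RawMonoid as RawMonoid
import Algebra.Properties.CommutativeSemigroup as CommutativeSemigroup
open import Data.Empty using (⊥-elim)
open import Data.Fin.Base using (Fin; toℕ; fromℕ<)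
import Data.Fin.Base as Fin
import Data.Fin.Properties as Fin
open import Data.Fin.Permutation using (Permutation′; _⟨$⟩ʳ_)
open import Data.Fin.Subset using (⁅_⁆; ⋃; ∣_∣; _∪_; _∈_; _∉_; inside; outside)
open import Data.Fin.Subset.Properties using (∉⊥; ∣⊥∣≡0; ∪-identityˡ; x∈⁅x⁆; x∈⁅y⁆⇒x≡y; x∈p∪q⁺; x∈p∪q⁻; ⊆-antisym)
open import Data.Integer.Base using (+_)
open import Data.List.Base using (List; []; _∷_; map; foldr; filter; length; applyUpTo; allFin)
import Data.List.Base as List
open import Data.List.Membership.Propositional using () renaming (_∈_ to _∈ₗ_)
open import Data.List.Membership.Propositional.Properties
open import Data.List.Membership.Propositional.Properties.WithK using (unique∧set⇒bag)
open import Data.List.Properties using (filter-accept; filter-reject; length-applyUpTo; length-map; map-∘)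
open import Data.List.Relation.Binary.BagAndSetEquality using (∼bag⇒↭)
open import Data.List.Relation.Binary.Permutation.Propositional.Properties using (↭-length)
open import Data.List.Relation.Unary.All as All using (All; []; _∷_)
import Data.List.Relation.Unary.All.Properties as All
open import Data.List.Relation.Unary.AllPairs using ([]; _∷_)
import Data.List.Relation.Unary.AllPairs.Properties as AllPairs
open import Data.List.Relation.Unary.Any using (here; there)
open import Data.List.Relation.Unary.Unique.Propositional using (Unique)
import Data.List.Relation.Unary.Unique.Propositional.Properties as Unique
import Data.List.Relation.Unary.Unique.DecPropositional.Properties as DecUnique
open import Data.Nat.Base using (ℕ; zero; suc; NonZero; _/_; _+_; _*_; _∸_; _≤_; _<_; ∣_-_∣)
import Data.Nat.Base as ℕ
open import Data.Nat.DivMod using (_%_)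
import Data.Nat.DivMod as ℕ
open import Data.Nat.Coprimality using (coprime⇒gcd≡1; gcd≡1⇒coprime; coprime-divisor)
import Data.Nat.Coprimality as Coprime
open import Data.Nat.Divisibility
open import Data.Nat.GCD
open import Data.Nat.GeneralisedArithmetic using (iterate)
import Data.Nat.Properties as ℕ
open import Data.Product.Base using (∃; _×_; _,_; proj₁; proj₂)
import Data.Rational.Base as ℚ
import Data.Rational.Properties as ℚ
open import Data.Sum.Base using (inj₁; inj₂; [_,_]′)
open import Data.Vec.Base using (_∷_; here; there)
open import Function.Base using (_∘_)
open import Function.Bundles using (mk⇔; module Injection)
open import Function.Properties.Inverse using (↔⇒↣)
open import Relation.Binary.Definitions using (DecidableEquality)
open import Relation.Binary.PropositionalEquality
open import Relation.Nullary.Negation using (contradiction)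

-- Finite sums and products over lists, regrouped by fibres.

module BigOperator {c ℓ} (M : CommutativeMonoid c ℓ) where
  open CommutativeMonoid M renaming (refl to ≈refl; sym to ≈sym; trans to ≈trans; _≈_ to _≋_)
  open RawMonoid rawMonoid using () renaming (_×_ to _·_)
  open CommutativeSemigroup commutativeSemigroup using (x∙yz≈y∙xz)

  -- For the multiplicative monoid of `polyRing`, `⨀` unfolds to `∏` and `n · p` to `p ^ n`, so the
  -- lemmas of this module apply to `ctype` as it stands.
  ⨀ : ∀ {a} {A : Set a} → List A → (A → Carrier) → Carrier
  ⨀ as f = foldr _∙_ ε (map f as)

  ⨀-cong : ∀ {a} {A : Set a} {f g : A → Carrier} {as} → All (λ a → f a ≋ g a) as → ⨀ as f ≋ ⨀ as g
  ⨀-cong []         = ≈refl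
  ⨀-cong (eq ∷ eqs) = ∙-cong eq (⨀-cong eqs)

  ⨀-ε : ∀ {a} {A : Set a} (as : List A) → ⨀ as (λ _ → ε) ≋ ε
  ⨀-ε []       = ≈refl
  ⨀-ε (_ ∷ as) = ≈trans (identityˡ _) (⨀-ε as)

  module _ {a} {A K : Set a} (_≟_ : DecidableEquality K) (f : A → K) (g : K → Carrier) where

    private
      count : List A → K → ℕ
      count as k = length (filter (λ a → f a ≟ k) as)

      count-∷-≡ : ∀ a as → count (a ∷ as) (f a) ≡ suc (count as (f a))
      count-∷-≡ a as = cong length (filter-accept (λ b → f b ≟ f a) refl)

      count-∷-≢ : ∀ {k} a as → f a ≢ k → count (a ∷ as) k ≡ count as k
      count-∷-≢ {k} a as fa≢k = cong length (filter-reject (λ b → f b ≟ k) fa≢k)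

      -- Since `ks` has no repetition, exactly one factor changes: the count at `f a` grows by one
      -- and yields an extra `g (f a)`, which commutativity brings to the front.
      insert : ∀ a as {ks} → Unique ks → f a ∈ₗ ks →
               ⨀ ks (λ k → count (a ∷ as) k · g k) ≋ g (f a) ∙ ⨀ ks (λ k → count as k · g k)
      insert a as (fa∉ ∷ _) (here refl) = ≈trans
        (∙-cong (reflexive (cong (_· g (f a)) (count-∷-≡ a as)))
                (⨀-cong (All.map (λ {k} fa≢k → reflexive (cong (_· g k) (count-∷-≢ a as fa≢k))) fa∉)))
        (assoc _ _ _)
      insert a as (_∷_ {k} k∉ uks) (there fa∈) = ≈trans
        (∙-cong (reflexive (cong (_· g k) (count-∷-≢ a as (λ fa≡k → All.lookup k∉ fa∈ (sym fa≡k)))))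
                (insert a as uks fa∈))
        (x∙yz≈y∙xz _ _ _)

    -- Both sides hold one factor `g (f a)` per entry `a`, gathered by key on the left. The proof is
    -- an induction on `as` with `insert` as its step.
    ⨀-fibres : ∀ {as ks} → Unique ks → All (λ a → f a ∈ₗ ks) as →
               ⨀ ks (λ k → length (filter (λ a → f a ≟ k) as) · g k) ≋ ⨀ as (g ∘ f)
    ⨀-fibres {[]}     {ks} uks []            = ⨀-ε ks
    ⨀-fibres {a ∷ as}      uks (fa∈ ∷ fas∈) =
      ≈trans (insert a as uks fa∈) (∙-congˡ (⨀-fibres uks fas∈))

module ∏ = BigOperator (CommutativeRing.*-commutativeMonoid polyRing)
module ∑ = BigOperator (CommutativeRing.+-commutativeMonoid polyRing)
module Sum = BigOperator ℕ.+-0-commutativeMonoid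

open ≡-Reasoning

≡⇒≈ : ∀ {p q} → p ≡ q → p ≈ q
≡⇒≈ refl = ≈-refl

-- Counting with lists without repetition.

[1⋯]-unique : ∀ n → Unique [1⋯ n ]
[1⋯]-unique n = Unique.applyUpTo⁺₁ suc n (λ i<j _ → ℕ.<⇒≢ i<j ∘ ℕ.suc-injective)

-- Lists without repetition that have the same members are permutations of each other.
Unique-length : ∀ {a} {A : Set a} {xs ys : List A} → Unique xs → Unique ys →
                (∀ {z} → z ∈ₗ xs → z ∈ₗ ys) → (∀ {z} → z ∈ₗ ys → z ∈ₗ xs) → length xs ≡ length ys
Unique-length uxs uys xs⊆ys ys⊆xs = ↭-length (∼bag⇒↭ (unique∧set⇒bag uxs uys (mk⇔ xs⊆ys ys⊆xs)))

Unique-length-via : ∀ {a b} {A : Set a} {B : Set b} (h : A → B) → (∀ {u v} → h u ≡ h v → u ≡ v) →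
  ∀ {xs ys} → Unique xs → Unique ys → (∀ {u} → u ∈ₗ xs → h u ∈ₗ ys) →
  (∀ {v} → v ∈ₗ ys → ∃ λ u → u ∈ₗ xs × v ≡ h u) → length xs ≡ length ys
Unique-length-via h h-inj {xs} {ys} uxs uys into onto = trans (sym (length-map h xs))
  (Unique-length (Unique.map⁺ h-inj uxs) uys
    (λ z∈ → let u , u∈ , eq = ∈-map⁻ h z∈ in subst (_∈ₗ ys) (sym eq) (into u∈))
    (λ z∈ → let u , u∈ , eq = onto z∈ in subst (_∈ₗ map h xs) (sym eq) (∈-map⁺ h u∈)))

-- Later this yields a list with one representative point for each cycle.
map-preimage : ∀ {a b} {A : Set a} {B : Set b} (f : A → B) {bs} → All (λ b → ∃ λ a → b ≡ f a) bs →
               ∃ λ as → bs ≡ map f as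
map-preimage f []                = [] , refl
map-preimage f ((a , refl) ∷ ps) with as , refl ← map-preimage f ps = a ∷ as , refl

-- Double counting: `⨀-fibres` in the additive monoid of the naturals, with `g` constantly 1.
fibres-constant : ∀ {A K : Set} (_≟_ : DecidableEquality K) (f : A → K) {as ks} m → Unique ks →
  All (λ a → f a ∈ₗ ks) as → All (λ k → length (filter (λ a → f a ≟ k) as) ≡ m) ks →
  length as ≡ length ks * m
fibres-constant _≟_ f {as} {ks} m uks as∈ counts = begin
  length as                              ≡⟨ ones as ⟨
  Sum.⨀ as (λ _ → 1)                     ≡⟨ Sum.⨀-fibres _≟_ f (λ _ → 1) uks as∈ ⟨
  Sum.⨀ ks (λ k → count k · 1)           ≡⟨ Sum.⨀-cong (All.map (λ {k} eq → trans (·-1 (count k)) eq) counts) ⟩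
  Sum.⨀ ks (λ _ → m)                     ≡⟨ constants ks ⟩
  length ks * m                          ∎
  where
  open RawMonoid ℕ.+-0-rawMonoid using () renaming (_×_ to _·_)
  count = λ k → length (filter (λ a → f a ≟ k) as)
  ·-1 : ∀ k → k · 1 ≡ k
  ·-1 zero    = refl
  ·-1 (suc k) = cong suc (·-1 k)
  ones : ∀ {A : Set} (as : List A) → Sum.⨀ as (λ _ → 1) ≡ length as
  ones []       = refl
  ones (_ ∷ as) = cong suc (ones as)
  constants : ∀ {A : Set} (as : List A) → Sum.⨀ as (λ _ → m) ≡ length as * m
  constants []       = refl
  constants (_ ∷ as) = cong (ℕ._+_ m) (constants as)

-- Finite subsets as unions of singletons.

∈-⋃⁅⁆⁺ : ∀ {N} {i : Fin N} {is} → i ∈ₗ is → i ∈ ⋃ (map ⁅_⁆ is)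
∈-⋃⁅⁆⁺ (here refl)  = x∈p∪q⁺ (inj₁ (x∈⁅x⁆ _))
∈-⋃⁅⁆⁺ (there i∈is) = x∈p∪q⁺ (inj₂ (∈-⋃⁅⁆⁺ i∈is))

∈-⋃⁅⁆⁻ : ∀ {N} {i : Fin N} is → i ∈ ⋃ (map ⁅_⁆ is) → i ∈ₗ is
∈-⋃⁅⁆⁻ []       i∈ = ⊥-elim (∉⊥ i∈)
∈-⋃⁅⁆⁻ (j ∷ is) i∈ = [ here ∘ x∈⁅y⁆⇒x≡y j , there ∘ ∈-⋃⁅⁆⁻ is ]′ (x∈p∪q⁻ ⁅ j ⁆ _ i∈)

∣⁅i⁆∪p∣ : ∀ {N} {i : Fin N} {p} → i ∉ p → ∣ ⁅ i ⁆ ∪ p ∣ ≡ suc ∣ p ∣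
∣⁅i⁆∪p∣ {i = Fin.zero}  {inside  ∷ p} i∉ = ⊥-elim (i∉ here)
∣⁅i⁆∪p∣ {i = Fin.zero}  {outside ∷ p} i∉ = cong (suc ∘ ∣_∣) (∪-identityˡ p)
∣⁅i⁆∪p∣ {i = Fin.suc i} {inside  ∷ p} i∉ = cong suc (∣⁅i⁆∪p∣ (i∉ ∘ there))
∣⁅i⁆∪p∣ {i = Fin.suc i} {outside ∷ p} i∉ = ∣⁅i⁆∪p∣ (i∉ ∘ there)

∣⋃⁅⁆∣ : ∀ {N} {is : List (Fin N)} → Unique is → ∣ ⋃ (map ⁅_⁆ is) ∣ ≡ length is
∣⋃⁅⁆∣ {N} []                    = ∣⊥∣≡0 N
∣⋃⁅⁆∣ {is = i ∷ is} (i∉ ∷ uis) =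
  trans (∣⁅i⁆∪p∣ (λ i∈ → All.lookup i∉ (∈-⋃⁅⁆⁻ is i∈) refl)) (cong suc (∣⋃⁅⁆∣ uis))

-- Cycle type of a permutation whose cycle lengths are read off an invariant.

iterate≡applyUpTo : ∀ {a} {A : Set a} (f : A → A) z n → List.iterate f z n ≡ applyUpTo (iterate f z) n
iterate≡applyUpTo f z zero    = refl
iterate≡applyUpTo f z (suc n) = cong (z ∷_) (iterate≡applyUpTo f (f z) n)

iterate-+ : ∀ {a} {A : Set a} (f : A → A) z m n → iterate f z (m + n) ≡ iterate f (iterate f z m) n
iterate-+ f z zero    n = refl
iterate-+ f z (suc m) n = iterate-+ f (f z) m n

-- An abstract setting: `D` is constant along cycles, and `returns` together with `minimal` makes
-- `ρ (D i)` the exact length of the cycle through `i`. It is applied below with `D` the denominator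
-- of i / n and `ρ` the order `r a`.
module CycleType {N} (π : Permutation′ N) (D : Fin N → ℕ) (ρ : ℕ → ℕ) {{ρ≢0 : ∀ {d} → NonZero (ρ d)}}
  (D-invariant : ∀ i → D (π ⟨$⟩ʳ i) ≡ D i)
  (returns : ∀ i → iterate (π ⟨$⟩ʳ_) i (ρ (D i)) ≡ i)
  (minimal : ∀ i k .{{_ : NonZero k}} → iterate (π ⟨$⟩ʳ_) i k ≡ i → ρ (D i) ≤ k)
  where

  private
    f : Fin N → Fin N
    f = π ⟨$⟩ʳ_

    period : Fin N → ℕ
    period i = ρ (D i)

    orbit : Fin N → List (Fin N)
    orbit i = applyUpTo (iterate f i) (period i)

  D-iterate : ∀ i k → D (iterate f i k) ≡ D i
  D-iterate i zero    = refl
  D-iterate i (suc k) = trans (D-iterate (f i) k) (D-invariant i)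

  iterate-injective : ∀ k {i j} → iterate f i k ≡ iterate f j k → i ≡ j
  iterate-injective zero    eq = eq
  iterate-injective (suc k) eq = Injection.injective (↔⇒↣ π) (iterate-injective k eq)

  -- If the iterates agreed, cancelling `u` steps would give a return to `i` after `v ∸ u` steps, a
  -- positive number below the period, against `minimal`.
  iterate-distinct : ∀ i {u v} → u < v → v < period i → iterate f i u ≢ iterate f i v
  iterate-distinct i {u} {v} u<v v<p eq = ℕ.<⇒≱ v<p (ℕ.≤-trans
    (minimal i w {{ℕ.>-nonZero (ℕ.m<n⇒0<n∸m u<v)}} back)
    (ℕ.m∸n≤m v u))
    where
    w = v ∸ u
    back : iterate f i w ≡ i
    back = iterate-injective u (begin
      iterate f (iterate f i w) u ≡⟨ iterate-+ f i w u ⟨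
      iterate f i (w + u)         ≡⟨ cong (iterate f i) (ℕ.m∸n+n≡m (ℕ.<⇒≤ u<v)) ⟩
      iterate f i v               ≡⟨ eq ⟨
      iterate f i u               ∎)

  -- More than `N` distinct iterates do not fit in `Fin N`. The bound ensures that the `N` iterates
  -- taken in `cycle` run through the whole orbit.
  period≤N : ∀ i → period i ≤ N
  period≤N i = ℕ.≮⇒≥ λ N<p →
    let u , v , u<v , eq = Fin.pigeonhole N<p (iterate f i ∘ toℕ)
    in iterate-distinct i u<v (Fin.toℕ<n v) eq

  iterate-period : ∀ i q → iterate f i (q * period i) ≡ i
  iterate-period i zero    = refl
  iterate-period i (suc q) = begin
    iterate f i (period i + q * period i)             ≡⟨ iterate-+ f i (period i) _ ⟩
    iterate f (iterate f i (period i)) (q * period i) ≡⟨ cong (λ j → iterate f j (q * period i)) (returns i) ⟩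
    iterate f i (q * period i)                        ≡⟨ iterate-period i q ⟩
    i                                                 ∎

  iterate-% : ∀ i k → iterate f i k ≡ iterate f i (k % period i)
  iterate-% i k = begin
    iterate f i k                                       ≡⟨ cong (iterate f i) (trans (ℕ.m≡m%n+[m/n]*n k p) (ℕ.+-comm (k % p) _)) ⟩
    iterate f i (k / p * p + k % p)                     ≡⟨ iterate-+ f i (k / p * p) _ ⟩
    iterate f (iterate f i (k / p * p)) (k % p)         ≡⟨ cong (λ j → iterate f j (k % p)) (iterate-period i (k / p)) ⟩
    iterate f i (k % p)                                 ∎
    where p = period i

  orbit-unique : ∀ i → Unique (orbit i)
  orbit-unique i = Unique.applyUpTo⁺₁ (iterate f i) (period i) (iterate-distinct i)

  iterate∈orbit : ∀ i k → iterate f i k ∈ₗ orbit i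
  iterate∈orbit i k = subst (_∈ₗ orbit i) (sym (iterate-% i k)) (∈-applyUpTo⁺ (iterate f i) (ℕ.m%n<n k (period i)))

  -- `cycle` collects `N` iterates, possibly with repetitions. Reducing their indices modulo the
  -- period gives one inclusion; `period≤N` gives the other.
  cycle≡⋃orbit : ∀ i → cycle π i ≡ ⋃ (map ⁅_⁆ (orbit i))
  cycle≡⋃orbit i = trans (cong (⋃ ∘ map ⁅_⁆) (iterate≡applyUpTo f i N)) (⊆-antisym
    (λ j∈ → ∈-⋃⁅⁆⁺ (to (∈-⋃⁅⁆⁻ (applyUpTo (iterate f i) N) j∈)))
    (λ j∈ → ∈-⋃⁅⁆⁺ (from (∈-⋃⁅⁆⁻ (orbit i) j∈))))
    where
    to : ∀ {j} → j ∈ₗ applyUpTo (iterate f i) N → j ∈ₗ orbit i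
    to j∈ with k , _ , refl ← ∈-applyUpTo⁻ (iterate f i) j∈ = iterate∈orbit i k
    from : ∀ {j} → j ∈ₗ orbit i → j ∈ₗ applyUpTo (iterate f i) N
    from j∈ with k , k<p , refl ← ∈-applyUpTo⁻ (iterate f i) j∈ =
      ∈-applyUpTo⁺ (iterate f i) (ℕ.<-≤-trans k<p (period≤N i))

  ∣cycle∣ : ∀ i → ∣ cycle π i ∣ ≡ period i
  ∣cycle∣ i = begin
    ∣ cycle π i ∣              ≡⟨ cong ∣_∣ (cycle≡⋃orbit i) ⟩
    ∣ ⋃ (map ⁅_⁆ (orbit i)) ∣  ≡⟨ ∣⋃⁅⁆∣ (orbit-unique i) ⟩
    length (orbit i)           ≡⟨ length-applyUpTo (iterate f i) (period i) ⟩
    period i                   ∎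

  iterate∈cycle : ∀ i k → iterate f i k ∈ cycle π i
  iterate∈cycle i k = subst (iterate f i k ∈_) (sym (cycle≡⋃orbit i)) (∈-⋃⁅⁆⁺ (iterate∈orbit i k))

  cycle⊆orbit : ∀ i {j} → j ∈ cycle π i → j ∈ₗ orbit i
  cycle⊆orbit i j∈ = ∈-⋃⁅⁆⁻ (orbit i) (subst (_ ∈_) (cycle≡⋃orbit i) j∈)

  cycle-orbit : ∀ i {j} → j ∈ₗ orbit i → cycle π j ≡ cycle π i
  cycle-orbit i {j} j∈ with k , k<p , refl ← ∈-applyUpTo⁻ (iterate f i) j∈ = ⊆-antisym to from
    where
    to : ∀ {z} → z ∈ cycle π j → z ∈ cycle π i
    to z∈ with m , _ , refl ← ∈-applyUpTo⁻ (iterate f j) (cycle⊆orbit j z∈) =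
      subst (_∈ cycle π i) (iterate-+ f i k m) (iterate∈cycle i (k + m))
    -- Since `j` is the `k`-th iterate of `i`, the remaining `period i ∸ k` steps close the cycle at
    -- `i`; hence every iterate of `i` is also one of `j`.
    back : iterate f j (period i ∸ k) ≡ i
    back = begin
      iterate f j (period i ∸ k)        ≡⟨ iterate-+ f i k _ ⟨
      iterate f i (k + (period i ∸ k))  ≡⟨ cong (iterate f i) (ℕ.m+[n∸m]≡n (ℕ.<⇒≤ k<p)) ⟩
      iterate f i (period i)            ≡⟨ returns i ⟩
      i                                 ∎
    from : ∀ {z} → z ∈ cycle π i → z ∈ cycle π j
    from z∈ with m , _ , refl ← ∈-applyUpTo⁻ (iterate f i) (cycle⊆orbit i z∈) =
      subst (_∈ cycle π j) (trans (iterate-+ f j (period i ∸ k) m) (cong (λ i → iterate f i m) back))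
        (iterate∈cycle j ((period i ∸ k) + m))

  D-orbit : ∀ i {j} → j ∈ₗ orbit i → D j ≡ D i
  D-orbit i j∈ with k , _ , refl ← ∈-applyUpTo⁻ (iterate f i) j∈ = D-iterate i k

  D-cycle : ∀ i j → i ∈ cycle π j → D i ≡ D j
  D-cycle i j i∈ = D-orbit j (cycle⊆orbit j i∈)

  private
    -- `cycles` lists subsets, whereas `D` is defined on points. One point chosen from each cycle
    -- allows the cycles to be sorted by `D`.
    preimages : ∃ λ reps → cycles π ≡ map (cycle π) reps
    preimages = map-preimage (cycle π) (All.tabulate λ c∈ →
      let j , _ , eq = ∈-map⁻ (cycle π) (∈-deduplicate⁻ _≟ₛ_ _ c∈) in j , eq)

    reps : List (Fin N)
    reps = proj₁ preimages

    cycles≡ : cycles π ≡ map (cycle π) reps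
    cycles≡ = proj₂ preimages

    reps-unique : Unique (map (cycle π) reps)
    reps-unique = subst Unique cycles≡ (DecUnique.deduplicate-! _≟ₛ_ _)

    level : ℕ → List (Fin N) → List (Fin N)
    level d = filter (λ i → D i ℕ.≟ d)

    -- As `D` is constant on each cycle, the points of level `d` split into the cycles of the
    -- representatives of level `d`, and each of these has `ρ d` points.
    cycle-count : ∀ d → length (level d (allFin N)) ≡ length (level d reps) * ρ d
    cycle-count d = trans
      (fibres-constant _≟ₛ_ (cycle π) (ρ d) level-unique covered (All.map⁺ (All.tabulate fibre)))
      (cong (_* ρ d) (length-map (cycle π) (level d reps)))
      where
      level-unique : Unique (map (cycle π) (level d reps))
      level-unique = AllPairs.map⁺ (AllPairs.filter⁺ (λ i → D i ℕ.≟ d) (AllPairs.map⁻ reps-unique))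

      covered : All (λ i → cycle π i ∈ₗ map (cycle π) (level d reps)) (level d (allFin N))
      covered = All.tabulate cover
        where
        cover : ∀ {i} → i ∈ₗ level d (allFin N) → cycle π i ∈ₗ map (cycle π) (level d reps)
        cover {i} i∈ with _ , Di≡d ← ∈-filter⁻ (λ i → D i ℕ.≟ d) {xs = allFin N} i∈
          -- The cycle of `i` is that of some representative `j`. Being its own zeroth iterate, `i`
          -- lies on that cycle, so `D j` equals `D i` and `j` has level `d` too.
          with j , j∈reps , eq ← ∈-map⁻ (cycle π) (subst (cycle π i ∈ₗ_) cycles≡
                 (∈-deduplicate⁺ _≟ₛ_ (∈-map⁺ (cycle π) (∈-allFin i))))
          = subst (_∈ₗ map (cycle π) (level d reps)) (sym eq)
              (∈-map⁺ (cycle π) (∈-filter⁺ (λ i → D i ℕ.≟ d) j∈reps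
                (trans (sym (D-cycle i j (subst (i ∈_) eq (iterate∈cycle i 0)))) Di≡d)))

      -- The points of level `d` that share the cycle of `j` are exactly the members of `orbit j`.
      fibre : ∀ {j} → j ∈ₗ level d reps →
              length (filter (λ i → cycle π i ≟ₛ cycle π j) (level d (allFin N))) ≡ ρ d
      fibre {j} j∈ with _ , refl ← ∈-filter⁻ (λ i → D i ℕ.≟ d) {xs = reps} j∈ = trans
        (Unique-length
          (Unique.filter⁺ _ (Unique.filter⁺ _ (Unique.allFin⁺ N)))
          (orbit-unique j) to from)
        (length-applyUpTo (iterate f j) (ρ (D j)))
        where
        to : ∀ {i} → i ∈ₗ filter (λ i → cycle π i ≟ₛ cycle π j) (level d (allFin N)) → i ∈ₗ orbit j
        to {i} i∈ = cycle⊆orbit j (subst (i ∈_)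
          (proj₂ (∈-filter⁻ (λ i → cycle π i ≟ₛ cycle π j) {xs = level d (allFin N)} i∈)) (iterate∈cycle i 0))
        from : ∀ {i} → i ∈ₗ orbit j → i ∈ₗ filter (λ i → cycle π i ≟ₛ cycle π j) (level d (allFin N))
        from {i} i∈ = ∈-filter⁺ (λ i → cycle π i ≟ₛ cycle π j)
          (∈-filter⁺ (λ i → D i ℕ.≟ D j) (∈-allFin i) (D-orbit j i∈)) (cycle-orbit j i∈)

  -- By cycle-count, ρ d divides the number of points of level d, so the
  -- quotient below is exact.

  ctype-levels : ∀ {ds} → Unique ds → (∀ i → D i ∈ₗ ds) →
    ctype π ≈ (∏[ d ← ds ] x (ρ d) ^ (length (filter (λ i → D i ℕ.≟ d) (allFin N)) / ρ d))
  ctype-levels {ds} uds D∈ds =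
    -- The product over sizes becomes one over cycles, then one over representatives `i` with factor
    -- `x (ρ (D i))`, which is regrouped by the value of `D`. Finally `cycle-count` turns each
    -- number of representatives into the stated quotient.
    ≈-trans (∏.⨀-fibres ℕ._≟_ ∣_∣ x ([1⋯]-unique N) sizes)
    (≈-trans (≡⇒≈ (trans (cong (λ cs → ∏ cs (x ∘ ∣_∣)) cycles≡) (cong (foldr _⊗_ _) (sym (map-∘ reps)))))
    (≈-trans (∏.⨀-cong {as = reps} (All.tabulate λ {i} _ → ≡⇒≈ (cong x (∣cycle∣ i))))
    (≈-trans (≈-sym (∏.⨀-fibres ℕ._≟_ D (x ∘ ρ) {as = reps} uds (All.tabulate λ {i} _ → D∈ds i)))
    (∏.⨀-cong {as = ds} (All.tabulate λ {d} _ → ≡⇒≈ (cong (x (ρ d) ^_) (sym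
      (trans (cong (_/ ρ d) (cycle-count d)) (ℕ.m*n/n≡m (length (level d reps)) (ρ d))))))))))
    where
    sizes : All (λ c → ∣ c ∣ ∈ₗ [1⋯ N ]) (cycles π)
    sizes = subst (All _) (sym cycles≡) (All.map⁺ (All.tabulate λ {i} _ → size i))
      where
      size : ∀ i → ∣ cycle π i ∣ ∈ₗ [1⋯ N ]
      -- The list starts at 1, so the size must be nonzero as well as at most `N`; it is written as
      -- a successor to match `applyUpTo suc`.
      size i = subst (_∈ₗ [1⋯ N ]) (trans (ℕ.suc-pred (period i)) (sym (∣cycle∣ i)))
        (∈-applyUpTo⁺ suc (subst (_≤ N) (sym (ℕ.suc-pred (period i))) (period≤N i)))

-- Greatest common divisors and the count of units.

gcd-*ʳ : ∀ m n g → gcd (m * g) (n * g) ≡ gcd m n * g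
gcd-*ʳ m n g = begin
  gcd (m * g) (n * g) ≡⟨ cong₂ gcd (ℕ.*-comm m g) (ℕ.*-comm n g) ⟩
  gcd (g * m) (g * n) ≡⟨ c*gcd[m,n]≡gcd[cm,cn] g m n ⟨
  g * gcd m n         ≡⟨ ℕ.*-comm g _ ⟩
  gcd m n * g         ∎

-- A common divisor of `a * m` and `n` is coprime to `a`, because `gcd a n ≡ 1`, so it divides `m`.
gcd-cancelˡ : ∀ a m n → gcd a n ≡ 1 → gcd (a * m) n ≡ gcd m n
gcd-cancelˡ a m n c = ∣-antisym
  (gcd-greatest
    (coprime-divisor {n = a}
      (λ (w∣z , w∣a) → gcd≡1⇒coprime {a} {n} c (w∣a , ∣-trans w∣z (gcd[m,n]∣n (a * m) n)))
      (gcd[m,n]∣m (a * m) n))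
    (gcd[m,n]∣n (a * m) n))
  (gcd-greatest (∣n⇒∣m*n a (gcd[m,n]∣m m n)) (gcd[m,n]∣n m n))

gcd-%ˡ : ∀ m n .{{_ : NonZero n}} → gcd (m % n) n ≡ gcd m n
gcd-%ˡ m n = ∣-antisym
  (gcd-greatest (∣n∣m%n⇒∣m (gcd[m,n]∣n (m % n) n) (gcd[m,n]∣m (m % n) n)) (gcd[m,n]∣n (m % n) n))
  (gcd-greatest (%-presˡ-∣ (gcd[m,n]∣m m n) (gcd[m,n]∣n m n)) (gcd[m,n]∣n m n))

gcd-diag : ∀ n → gcd n n ≡ n
gcd-diag n = ∣-antisym (gcd[m,n]∣m n n) (gcd-greatest ∣-refl ∣-refl)

coprime-∣ : ∀ a {d n} → d ∣ n → gcd a n ≡ 1 → gcd a d ≡ 1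
coprime-∣ a {d} {n} d∣n c = coprime⇒gcd≡1 λ (z∣a , z∣d) →
  gcd≡1⇒coprime {a} {n} c (z∣a , ∣-trans z∣d d∣n)

-- φ counts over 1, …, d, so the residue 0 stands for d.

φ≡#units : ∀ d .{{_ : NonZero d}} → φ d ≡ length (filter (unit? d) (allFin d))
φ≡#units d@(suc m) = sym (Unique-length-via h h-injective
  (Unique.filter⁺ (unit? d) (Unique.allFin⁺ d))
  (Unique.filter⁺ coprime? ([1⋯]-unique d))
  into onto)
  where
  coprime? = λ k → gcd k d ℕ.≟ 1
  h : Fin d → ℕ
  h Fin.zero    = d
  h (Fin.suc i) = suc (toℕ i)
  h-injective : ∀ {i j} → h i ≡ h j → i ≡ j
  h-injective {Fin.zero}  {Fin.zero}  eq = refl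
  h-injective {Fin.zero}  {Fin.suc j} eq = contradiction (ℕ.suc-injective (sym eq)) (ℕ.<⇒≢ (Fin.toℕ<n j))
  h-injective {Fin.suc i} {Fin.zero}  eq = contradiction (ℕ.suc-injective eq) (ℕ.<⇒≢ (Fin.toℕ<n i))
  h-injective {Fin.suc i} {Fin.suc j} eq = cong Fin.suc (Fin.toℕ-injective (ℕ.suc-injective eq))
  h-gcd : ∀ i → gcd (h i) d ≡ gcd (toℕ i) d
  h-gcd Fin.zero    = trans (gcd-diag d) (sym (gcd-identityˡ d))
  h-gcd (Fin.suc i) = refl
  h∈ : ∀ i → h i ∈ₗ [1⋯ d ]
  h∈ Fin.zero    = ∈-applyUpTo⁺ suc (ℕ.n<1+n m)
  h∈ (Fin.suc i) = ∈-applyUpTo⁺ suc (ℕ.m<n⇒m<1+n (Fin.toℕ<n i))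
  h-onto : ∀ {k} → k < d → ∃ λ i → suc k ≡ h i
  h-onto {k} k<d with ℕ.m≤n⇒m<n∨m≡n (ℕ.≤-pred k<d)
  ... | inj₁ k<m  = Fin.suc (fromℕ< k<m) , cong suc (sym (Fin.toℕ-fromℕ< k<m))
  ... | inj₂ refl = Fin.zero , refl
  into : ∀ {i} → i ∈ₗ filter (unit? d) (allFin d) → h i ∈ₗ filter coprime? [1⋯ d ]
  into {i} i∈ = ∈-filter⁺ coprime? (h∈ i)
    (trans (h-gcd i) (proj₂ (∈-filter⁻ (unit? d) {xs = allFin d} i∈)))
  onto : ∀ {k} → k ∈ₗ filter coprime? [1⋯ d ] → ∃ λ i → i ∈ₗ filter (unit? d) (allFin d) × k ≡ h i
  onto k∈ with k∈′ , c ← ∈-filter⁻ coprime? {xs = [1⋯ d ]} k∈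
          with _ , k<d , refl ← ∈-applyUpTo⁻ suc k∈′
          with i , eq ← h-onto k<d
    = i , ∈-filter⁺ (unit? d) (∈-allFin i) (trans (sym (h-gcd i)) (trans (cong (λ k → gcd k d) (sym eq)) c)) , eq

-- Denominators of the fractions i / n and multiplication by units.

module _ (n : ℕ) .{{n≢0 : NonZero n}} where

  -- The denominator of i / n in lowest terms, i.e. the additive order of i in ℤₙ.

  denominator : Fin n → ℕ
  denominator i = quotient (gcd[m,n]∣n (toℕ i) n)

  private
    n≡denominator*gcd : ∀ i → n ≡ denominator i * gcd (toℕ i) n
    n≡denominator*gcd i = m∣n⇒n≡quotient*m (gcd[m,n]∣n (toℕ i) n)

    gcd≢0 : ∀ i → NonZero (gcd (toℕ i) n)
    gcd≢0 i = ℕ.m*n≢0⇒n≢0 (denominator i) {{subst NonZero (n≡denominator*gcd i) (ℕ.>-nonZero (ℕ.>-nonZero⁻¹ n))}}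

  denominator-unique : ∀ i d → n ≡ d * gcd (toℕ i) n → denominator i ≡ d
  denominator-unique i d eq = ℕ.*-cancelʳ-≡ _ d (gcd (toℕ i) n) {{gcd≢0 i}} (trans (sym (n≡denominator*gcd i)) eq)

  denominator∣n : ∀ i → denominator i ∣ n
  denominator∣n i = quotient-∣ (gcd[m,n]∣n (toℕ i) n)

  denominator≢0 : ∀ i → NonZero (denominator i)
  denominator≢0 i = quotient≢0 (gcd[m,n]∣n (toℕ i) n)

  -- The numerator of i / n in lowest terms; the point 0 becomes 0 / 1.
  numerator : Fin n → ℕ
  numerator i = quotient (gcd[m,n]∣m (toℕ i) n)

  private
    i≡numerator*gcd : ∀ i → toℕ i ≡ numerator i * gcd (toℕ i) n
    i≡numerator*gcd i = m∣n⇒n≡quotient*m (gcd[m,n]∣m (toℕ i) n)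

  -- Multiplied by `g`, the left side becomes the gcd of `toℕ i` and `n`, which is `g` itself; then
  -- `g` cancels.
  numerator⊥denominator : ∀ i → gcd (numerator i) (denominator i) ≡ 1
  numerator⊥denominator i = ℕ.*-cancelʳ-≡ _ 1 g {{gcd≢0 i}} (begin
    gcd (numerator i) (denominator i) * g         ≡⟨ gcd-*ʳ (numerator i) (denominator i) g ⟨
    gcd (numerator i * g) (denominator i * g)     ≡⟨ cong₂ gcd (i≡numerator*gcd i) (n≡denominator*gcd i) ⟨
    g                                             ≡⟨ ℕ.*-identityˡ g ⟨
    1 * g                                         ∎)
    where
    g = gcd (toℕ i) n

  -- A unit modulo `n` does not change the gcd of a residue with `n`, and this gcd determines the
  -- denominator.
  denominator-mult : ∀ a → gcd a n ≡ 1 → ∀ i → denominator (mult n a i) ≡ denominator i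
  denominator-mult a c i = denominator-unique (mult n a i) (denominator i)
    (trans (n≡denominator*gcd i) (cong (denominator i *_) (sym (begin
      gcd (toℕ (mult n a i)) n   ≡⟨ cong (λ z → gcd z n) (toℕ-mult n a i) ⟩
      gcd ((a * toℕ i) % n) n    ≡⟨ gcd-%ˡ (a * toℕ i) n ⟩
      gcd (a * toℕ i) n          ≡⟨ gcd-cancelˡ a (toℕ i) n c ⟩
      gcd (toℕ i) n              ∎))))

  private
    -- This form is compared with `n`, which is `denominator i` times the same gcd, to decide when
    -- `n` divides the difference.
    ∣b*i-i∣ : ∀ b i → ∣ b * toℕ i - toℕ i ∣ ≡ ∣ b - 1 ∣ * numerator i * gcd (toℕ i) n
    ∣b*i-i∣ b i = begin
      ∣ b * toℕ i - toℕ i ∣                       ≡⟨ cong (∣ b * toℕ i -_∣) (ℕ.*-identityˡ (toℕ i)) ⟨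
      ∣ b * toℕ i - 1 * toℕ i ∣                   ≡⟨ ℕ.*-distribʳ-∣-∣ (toℕ i) b 1 ⟨
      ∣ b - 1 ∣ * toℕ i                           ≡⟨ cong (∣ b - 1 ∣ *_) (i≡numerator*gcd i) ⟩
      ∣ b - 1 ∣ * (numerator i * gcd (toℕ i) n)   ≡⟨ ℕ.*-assoc ∣ b - 1 ∣ (numerator i) _ ⟨
      ∣ b - 1 ∣ * numerator i * gcd (toℕ i) n     ∎

    toℕ% : ∀ (i : Fin n) → toℕ i % n ≡ toℕ i
    toℕ% i = ℕ.m<n⇒m%n≡m (Fin.toℕ<n i)

  mult-fixes⁺ : ∀ b i → b ≡ 1 [mod denominator i ] → mult n b i ≡ i
  mult-fixes⁺ b i b≡1 = Fin.toℕ-injective (trans (toℕ-mult n b i) (trans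
    (≡mod⇒≡% (b * toℕ i) (toℕ i) n
      (subst₂ _∣_ (sym (n≡denominator*gcd i)) (sym (∣b*i-i∣ b i)) (*-monoˡ-∣ _ (∣m⇒∣m*n _ b≡1))))
    (toℕ% i)))

  -- A fixed point means that `n` divides the difference in `∣b*i-i∣`. The common gcd cancels, and
  -- then so does the numerator, which is coprime to the denominator.
  mult-fixes⁻ : ∀ b i → mult n b i ≡ i → b ≡ 1 [mod denominator i ]
  mult-fixes⁻ b i eq = coprime-divisor {n = numerator i} (Coprime.sym (gcd≡1⇒coprime (numerator⊥denominator i)))
    (subst (denominator i ∣_) (ℕ.*-comm ∣ b - 1 ∣ (numerator i)) (*-cancelʳ-∣ (gcd (toℕ i) n) {{gcd≢0 i}}
      (subst₂ _∣_ (n≡denominator*gcd i) (∣b*i-i∣ b i)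
        (≡%⇒≡mod (b * toℕ i) (toℕ i) n (trans (sym (toℕ-mult n b i)) (trans (cong toℕ eq) (sym (toℕ% i))))))))

  iterate-mult : ∀ a i k → iterate (mult n a) i k ≡ mult n (a ℕ.^ k) i
  iterate-mult a i zero    = sym (mult-1 n i)
  iterate-mult a i (suc k) = begin
    iterate (mult n a) (mult n a i) k   ≡⟨ iterate-mult a (mult n a i) k ⟩
    mult n (a ℕ.^ k) (mult n a i)       ≡⟨ mult-∘ n (a ℕ.^ k) a i ⟩
    mult n (a ℕ.^ k * a) i              ≡⟨ cong (λ b → mult n b i) (ℕ.*-comm (a ℕ.^ k) a) ⟩
    mult n (a ℕ.^ suc k) i              ∎

  -- With `g` equal to n / d, the points of denominator `d` are the multiples `k * g` for `k` below
  -- `d` and coprime to `d`: the fraction k / d equals k g / n.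
  denominator-count : ∀ d → d ∣ n → φ d ≡ length (filter (λ i → denominator i ℕ.≟ d) (allFin n))
  denominator-count d d∣n = trans (φ≡#units d {{d≢0}}) (Unique-length-via scale scale-injective
    (Unique.filter⁺ (unit? d) (Unique.allFin⁺ d))
    (Unique.filter⁺ (λ i → denominator i ℕ.≟ d) (Unique.allFin⁺ n))
    into onto)
    where
    g = quotient d∣n
    n≡ : n ≡ d * g
    n≡ = m∣n⇒n≡m*quotient d∣n
    d≢0 : NonZero d
    d≢0 = ℕ.m*n≢0⇒m≢0 d {{subst NonZero n≡ (ℕ.>-nonZero (ℕ.>-nonZero⁻¹ n))}}
    g≢0 : NonZero g
    g≢0 = quotient≢0 d∣n
    scale< : ∀ {k} → k < d → k * g < n
    scale< {k} k<d = subst (k * g <_) (sym n≡) (ℕ.*-monoˡ-< g {{g≢0}} k<d)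
    scale : Fin d → Fin n
    scale k = fromℕ< (scale< (Fin.toℕ<n k))
    toℕ-scale : ∀ k → toℕ (scale k) ≡ toℕ k * g
    toℕ-scale k = Fin.toℕ-fromℕ< _
    scale-injective : ∀ {k l} → scale k ≡ scale l → k ≡ l
    scale-injective {k} {l} eq = Fin.toℕ-injective (ℕ.*-cancelʳ-≡ _ _ g {{g≢0}}
      (trans (sym (toℕ-scale k)) (trans (cong toℕ eq) (toℕ-scale l))))
    gcd-scale : ∀ k → gcd (toℕ (scale k)) n ≡ gcd (toℕ k) d * g
    gcd-scale k = trans (cong₂ gcd (toℕ-scale k) n≡) (gcd-*ʳ (toℕ k) d g)
    into : ∀ {k} → k ∈ₗ filter (unit? d) (allFin d) → scale k ∈ₗ filter (λ i → denominator i ℕ.≟ d) (allFin n)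
    into {k} k∈ = ∈-filter⁺ (λ i → denominator i ℕ.≟ d) (∈-allFin _) (denominator-unique (scale k) d
      (trans n≡ (cong (d *_) (sym (trans (gcd-scale k) (trans
        (cong (_* g) (proj₂ (∈-filter⁻ (unit? d) {xs = allFin d} k∈))) (ℕ.*-identityˡ g)))))))
    onto : ∀ {i} → i ∈ₗ filter (λ i → denominator i ℕ.≟ d) (allFin n) →
           ∃ λ k → k ∈ₗ filter (unit? d) (allFin d) × i ≡ scale k
    -- The preimage of `i` is its numerator: `toℕ i` equals `q * g`, and `i` being below `n` forces
    -- `q` below `d`.
    onto {i} i∈ = k , ∈-filter⁺ (unit? d) (∈-allFin k) (trans (cong₂ gcd toℕ-k (sym den≡d)) (numerator⊥denominator i)) ,
      Fin.toℕ-injective (trans i≡q*g (trans (cong (_* g) (sym toℕ-k)) (sym (toℕ-scale k))))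
      where
      den≡d : denominator i ≡ d
      den≡d = proj₂ (∈-filter⁻ (λ i → denominator i ℕ.≟ d) {xs = allFin n} i∈)
      q = numerator i
      gcd≡g : gcd (toℕ i) n ≡ g
      gcd≡g = ℕ.*-cancelˡ-≡ _ g d {{d≢0}} (trans
        (cong (_* gcd (toℕ i) n) (sym den≡d))
        (trans (sym (n≡denominator*gcd i)) n≡))
      i≡q*g : toℕ i ≡ q * g
      i≡q*g = trans (i≡numerator*gcd i) (cong (q *_) gcd≡g)
      q<d : q < d
      q<d = ℕ.*-cancelʳ-< g q d (subst₂ _<_ i≡q*g n≡ (Fin.toℕ<n i))
      k = fromℕ< q<d
      toℕ-k : toℕ k ≡ q
      toℕ-k = Fin.toℕ-fromℕ< q<d

  -- Cycle types of units and the cycle index.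

  denominator∈divisors : ∀ i → denominator i ∈ₗ divisors n
  denominator∈divisors i = ∈-filter⁺ (_∣? n)
    (subst (_∈ₗ [1⋯ n ]) suc-pred (∈-applyUpTo⁺ suc (subst (_≤ n) (sym suc-pred) (∣⇒≤ (denominator∣n i)))))
    (denominator∣n i)
    where
    suc-pred : suc (ℕ.pred (denominator i)) ≡ denominator i
    suc-pred = ℕ.suc-pred (denominator i) {{denominator≢0 i}}

  divisors-unique : Unique (divisors n)
  divisors-unique = Unique.filter⁺ (_∣? n) ([1⋯]-unique n)

  ctype-π : ∀ a (c : gcd a n ≡ 1) → ctype (π n a c) ≈ (∏[ d ← divisors n ] x (r a d) ^ (φ d / r a d))
  ctype-π a c = ≈-trans
    -- `r a d` is a successor by definition, so its `NonZero` instance is filled in by `_`.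
    (CycleType.ctype-levels (π n a c) denominator (r a) {{λ {d} → _}} (denominator-mult a c) returns minimal
      divisors-unique denominator∈divisors)
    (∏.⨀-cong {as = divisors n} (All.tabulate λ {d} d∈ → ≡⇒≈ (cong (λ m → x (r a d) ^ (m / r a d))
      (sym (denominator-count d (proj₂ (∈-filter⁻ (_∣? n) {xs = [1⋯ n ]} d∈)))))))
    where
    order : ∀ i → (a ℕ.^ r a (denominator i) ≡ 1 [mod denominator i ]) ×
      (∀ k .{{_ : NonZero k}} → a ℕ.^ k ≡ 1 [mod denominator i ] → r a (denominator i) ≤ k)
    order i = r-spec a (denominator i) {{denominator≢0 i}} (coprime-∣ a (denominator∣n i) c)
    returns : ∀ i → iterate (mult n a) i (r a (denominator i)) ≡ i
    returns i = trans
      (iterate-mult a i (r a (denominator i)))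
      (mult-fixes⁺ (a ℕ.^ r a (denominator i)) i (proj₁ (order i)))
    minimal : ∀ i k .{{_ : NonZero k}} → iterate (mult n a) i k ≡ i → r a (denominator i) ≤ k
    minimal i k eq = proj₂ (order i) k (mult-fixes⁻ (a ℕ.^ k) i (trans (sym (iterate-mult a i k)) eq))

  order-𝒰 : PermutationGroup.order (𝒰 n) ≡ φ n
  order-𝒰 = begin
    length (map (πᵘ n) (units n))           ≡⟨ length-map (πᵘ n) (units n) ⟩
    length (units n)                        ≡⟨ length-toList (All.all-filter (unit? n) (allFin n)) ⟩
    length (filter (unit? n) (allFin n))    ≡⟨ φ≡#units n ⟨
    φ n                                     ∎
    where
    length-toList : ∀ {A : Set} {P : A → Set} {as} (pas : All P as) → length (All.toList pas) ≡ length as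
    length-toList []         = refl
    length-toList (_ ∷ pas)  = cong suc (length-toList pas)

corollary3p1 : ∀ (n : ℕ) .{{_ : NonZero n}} →
    (∀ (a : ℕ) .{{_ : NonZero a}} (coprime : gcd a n ≡ 1) →
    ctype (π n a coprime) ≈ (∏[ d ← divisors n ] x (r a d) ^ (φ d / r a d)))
    ×
    cycleIndex (𝒰 n) ≈
    con (+ 1 ℚ./ φ n) ⊗
    (∑[ a ← units n ] ∏[ d ← divisors n ] x (r (toℕ (proj₁ a)) d) ^ (φ d / r (toℕ (proj₁ a)) d))
corollary3p1 n = (λ a coprime → ctype-π n a coprime) ,
  ⊗-cong
    (≡⇒≈ (cong con (ℚ./-cong {p₁ = + 1} {{PermutationGroup.order-nonZero (𝒰 n)}} refl (order-𝒰 n))))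
    -- The group elements are themselves a mapped list; fusing the two maps turns the sum over
    -- permutations into one over residues.
    (≈-trans (≡⇒≈ (cong (foldr _⊕_ _) (sym (map-∘ (units n)))))
      (∑.⨀-cong {as = units n} (All.tabulate λ {(a , c)} _ → ctype-π n (toℕ a) c)))
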